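{- Let $G$ be a finite connected graph with chromatic number $\chi(G)=3$, and suppose $G$ is not isomorphic to the cycle $C_7$. Then $G$ admits a proper $3$-coloring $c:V(G)\to\{1,2,3\}$ such that every vertex $x$ of $G$ is the beginning of a colorful path, i.e. there is a path $x=x_1x_2x_3$ in $G$ (on three distinct vertices) with $c(x_1),c(x_2),c(x_3)$ pairwise distinct.
   Context: A proper $k$-coloring of a graph $G$ is a map $c:V(G)\to\{1,\dots,k\}$ with $c(u)\neq c(v)$ whenever $u,v$ are adjacent; $\chi(G)$ is the least such $k$. Given a $\chi(G)$-coloring, a colorful path is a path on $\chi(G)$ distinct vertices whose vertices receive pairwise distinct colors. -}

module Defs where

open import Data.Nat using (ℕ; zero; suc)
open import Data.Fin using (Fin; zero; suc)
open import Data.Bool using (Bool; true; false)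
open import Data.Product using (Σ; ∃; _×_; _,_)
open import Data.Sum using (_⊎_)
open import Relation.Nullary using (¬_)
open import Relation.Binary.PropositionalEquality using (_≡_)
open import Function.Bundles using (_↔_; Inverse)

record Graph : Set where
  field
    n     : ℕ
    adj   : Fin n → Fin n → Bool
    sym   : ∀ u v → adj u v ≡ adj v u
    irrefl : ∀ v → adj v v ≡ false

open Graph public

Adj : (G : Graph) → Fin (n G) → Fin (n G) → Set
Adj G u v = adj G u v ≡ true

data Walk (G : Graph) : Fin (n G) → Fin (n G) → Set where
  here : ∀ {u} → Walk G u u
  step : ∀ {u v w} → Adj G u v → Walk G v w → Walk G u w

Connected : Graph → Set
Connected G = Σ (Fin (n G)) (λ _ → ∀ u v → Walk G u v)

Proper : (G : Graph) (k : ℕ) → (Fin (n G) → Fin k) → Set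
Proper G k c = ∀ u v → Adj G u v → ¬ (c u ≡ c v)

Colorable : Graph → ℕ → Set
Colorable G k = Σ (Fin (n G) → Fin k) (Proper G k)

-- Chromatic number: χ(G) = k iff G is k-colorable and every proper
-- coloring needs at least k colours (not (k-1)-colorable; since
-- colorability is monotone in k this is equivalent to the least k).
ChromaticNumber : Graph → ℕ → Set
ChromaticNumber G zero    = Colorable G zero
ChromaticNumber G (suc k) = Colorable G (suc k) × ¬ Colorable G k

next7 : Fin 7 → Fin 7
next7 zero = suc zero
next7 (suc zero) = suc (suc zero)
next7 (suc (suc zero)) = suc (suc (suc zero))
next7 (suc (suc (suc zero))) = suc (suc (suc (suc zero)))
next7 (suc (suc (suc (suc zero)))) = suc (suc (suc (suc (suc zero))))
next7 (suc (suc (suc (suc (suc zero))))) = suc (suc (suc (suc (suc (suc zero)))))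
next7 (suc (suc (suc (suc (suc (suc zero)))))) = zero

C7Adj : Fin 7 → Fin 7 → Set
C7Adj i j = (j ≡ next7 i) ⊎ (i ≡ next7 j)

IsoC7 : Graph → Set
IsoC7 G = Σ (Fin (n G) ↔ Fin 7) λ f →
  ∀ u v → (Adj G u v → C7Adj (Inverse.to f u) (Inverse.to f v))
        × (C7Adj (Inverse.to f u) (Inverse.to f v) → Adj G u v)

ColorfulPathFrom : (G : Graph) → (Fin (n G) → Fin 3) → Fin (n G) → Set
ColorfulPathFrom G c x = ∃ λ y → ∃ λ z →
    Adj G x y × Adj G y z
  × ¬ (x ≡ y) × ¬ (y ≡ z) × ¬ (x ≡ z)
  × ¬ (c x ≡ c y) × ¬ (c y ≡ c z) × ¬ (c x ≡ c z)

{-# OPTIONS --safe #-}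
module Submission where

open import Defs
open import Data.Bool using (true) renaming (_≟_ to _≟ᵇ_)
open import Data.Empty using (⊥; ⊥-elim)
open import Data.Fin using (Fin; zero; suc; toℕ; fromℕ; inject₁; _<_)
open import Data.Fin.Induction using (<-wellFounded)
open import Data.Fin.Properties using (_≟_; toℕ-inject₁; all?; any?; ¬∀⟶∃¬; _<?_; <-cmp)
open import Data.Fin.Subset using (Subset; _∈_; _∪_; _⊃_; ⁅_⁆)
open import Data.Fin.Subset.Induction using (⊃-wellFounded)
open import Data.Fin.Subset.Properties
  using (_∈?_; x∈⁅x⁆; x∈⁅y⁆⇒x≡y; p⊆p∪q; q⊆p∪q; x∈p∪q⁻)
open import Data.Nat using (ℕ; zero; suc; s≤s)
open import Data.Product using (Σ; ∃; _×_; _,_; proj₁; proj₂)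
open import Data.Sum using (_⊎_; inj₁; inj₂)
open import Data.Vec using (Vec; []; _∷_; lookup; tabulate)
open import Data.Vec.Properties using (lookup∘tabulate)
open import Function.Bundles using (mk↔ₛ′)
open import Induction.WellFounded using (Acc; acc)
open import Relation.Binary.Definitions using (tri<; tri≈; tri>)
open import Relation.Binary.PropositionalEquality
  using (_≡_; _≢_; refl; trans; cong; subst; module ≡-Reasoning) renaming (sym to ≡-sym)
open import Relation.Nullary using (¬_; Dec; yes; no)
open import Relation.Nullary.Decidable
  using (map′; _×-dec_; _⊎-dec_; _→-dec_; ¬?; decidable-stable)

-- Orient every edge from colour i to colour i + 1 (mod 3): a vertex begins a colourful path
-- iff it begins or ends a directed path of length two.  Call it good then, and assume that
-- no colouring makes all vertices good.  Any colouring can be changed so that every vertex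
-- reaches a prescribed root r; r is then the only sink, and the vertices that are not good
-- (blocked) are those b → r with no other out-neighbour, all of whose in-neighbours are
-- sources.  Rotating b and its in-neighbours moves the root to b, so this can be iterated.
-- Either all blocked vertices can be repaired by rotating some sources together with a
-- common out-neighbour of them, or the in-neighbours of some blocked b are pairwise twins.
-- Following such b produces a chain of vertices of degree two; the graph is then C₇, or
-- bipartite, or exchanging two colours along the chain gives a good colouring.

-- Colours modulo three

rot : Fin 3 → Fin 3
rot zero             = suc zero
rot (suc zero)       = suc (suc zero)
rot (suc (suc zero)) = zero

rot³ : ∀ i → rot (rot (rot i)) ≡ i
rot³ zero             = refl
rot³ (suc zero)       = refl
rot³ (suc (suc zero)) = refl

rot≢ : ∀ i → i ≢ rot i
rot≢ zero             ()
rot≢ (suc zero)       ()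
rot≢ (suc (suc zero)) ()

rot²≢ : ∀ i → i ≢ rot (rot i)
rot²≢ zero             ()
rot²≢ (suc zero)       ()
rot²≢ (suc (suc zero)) ()

rot-injective : ∀ {i j} → rot i ≡ rot j → i ≡ j
rot-injective {i} {j} e = trans (≡-sym (rot³ i)) (trans (cong (λ k → rot (rot k)) e) (rot³ j))

rot-connex : ∀ i j → i ≢ j → j ≡ rot i ⊎ i ≡ rot j
rot-connex zero             zero             i≢j = ⊥-elim (i≢j refl)
rot-connex zero             (suc zero)       i≢j = inj₁ refl
rot-connex zero             (suc (suc zero)) i≢j = inj₂ refl
rot-connex (suc zero)       zero             i≢j = inj₂ refl
rot-connex (suc zero)       (suc zero)       i≢j = ⊥-elim (i≢j refl)
rot-connex (suc zero)       (suc (suc zero)) i≢j = inj₁ refl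
rot-connex (suc (suc zero)) zero             i≢j = inj₁ refl
rot-connex (suc (suc zero)) (suc zero)       i≢j = inj₂ refl
rot-connex (suc (suc zero)) (suc (suc zero)) i≢j = ⊥-elim (i≢j refl)

-- The orientation given by a colouring, and good vertices

module Orientation (G : Graph) where

  V : Set
  V = Fin (n G)

  infix 4 _∼_ _⊢_⟶_

  _∼_ : V → V → Set
  _∼_ = Adj G

  ∼-sym : ∀ {u v} → u ∼ v → v ∼ u
  ∼-sym {u} {v} u∼v = trans (≡-sym (sym G u v)) u∼v

  record _⊢_⟶_ (c : V → Fin 3) (u v : V) : Set where
    constructor edge
    field
      adjacent  : u ∼ v
      successor : c v ≡ rot (c u)

  open _⊢_⟶_ public

  _⊢_⟶?_ : ∀ c u v → Dec (c ⊢ u ⟶ v)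
  c ⊢ u ⟶? v = map′ (λ (a , e) → edge a e) (λ e → adjacent e , successor e)
    ((adj G u v ≟ᵇ true) ×-dec (c v ≟ rot (c u)))

  ⟶-asym : ∀ {c u v} → c ⊢ u ⟶ v → ¬ (c ⊢ v ⟶ u)
  ⟶-asym {c} {u} p q = rot²≢ (c u) (trans (successor q) (cong rot (successor p)))

  ⟶-irrefl : ∀ {c u} → ¬ (c ⊢ u ⟶ u)
  ⟶-irrefl p = ⟶-asym p p

  -- A directed triangle is the only kind of triangle a proper colouring allows.
  no-shortcut : ∀ {c u v w} → c ⊢ u ⟶ v → c ⊢ v ⟶ w → ¬ (c ⊢ u ⟶ w)
  no-shortcut {c} {u} p q r = rot≢ (rot (c u))
    (trans (≡-sym (successor r)) (trans (successor q) (cong rot (successor p))))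

  orient : ∀ {c u v} → Proper G 3 c → u ∼ v → c ⊢ u ⟶ v ⊎ c ⊢ v ⟶ u
  orient {c} {u} {v} pr u∼v with rot-connex (c u) (c v) (pr u v u∼v)
  ... | inj₁ e = inj₁ (edge u∼v e)
  ... | inj₂ e = inj₂ (edge (∼-sym u∼v) e)

  Good : (V → Fin 3) → V → Set
  Good c x = (∃ λ y → ∃ λ z → c ⊢ x ⟶ y × c ⊢ y ⟶ z)
           ⊎ (∃ λ y → ∃ λ z → c ⊢ y ⟶ x × c ⊢ z ⟶ y)

  Good? : ∀ c x → Dec (Good c x)
  Good? c x =
    any? (λ y → any? (λ z → (c ⊢ x ⟶? y) ×-dec (c ⊢ y ⟶? z))) ⊎-dec
    any? (λ y → any? (λ z → (c ⊢ y ⟶? x) ×-dec (c ⊢ z ⟶? y)))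

  Proper? : ∀ c → Dec (Proper G 3 c)
  Proper? c = all? (λ u → all? (λ v → (adj G u v ≟ᵇ true) →-dec ¬? (c u ≟ c v)))

  ⟶-resp : ∀ {c d u v} → (∀ x → c x ≡ d x) → c ⊢ u ⟶ v → d ⊢ u ⟶ v
  ⟶-resp {c} {d} {u} {v} c≗d (edge a e) =
    edge a (trans (≡-sym (c≗d v)) (trans e (cong rot (c≗d u))))

  Good-resp : ∀ {c d x} → (∀ y → c y ≡ d y) → Good c x → Good d x
  Good-resp e (inj₁ (y , z , p , q)) = inj₁ (y , z , ⟶-resp e p , ⟶-resp e q)
  Good-resp e (inj₂ (y , z , p , q)) = inj₂ (y , z , ⟶-resp e p , ⟶-resp e q)

  Good⇒Colorful : ∀ {c x} → Proper G 3 c → Good c x → ColorfulPathFrom G c x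
  Good⇒Colorful {c} {x} pr (inj₁ (y , z , p , q)) =
    y , z , adjacent p , adjacent q
    , (λ e → cx≢cy (cong c e)) , (λ e → cy≢cz (cong c e)) , (λ e → cx≢cz (cong c e))
    , cx≢cy , cy≢cz , cx≢cz
    where
    cx≢cy = pr x y (adjacent p)
    cy≢cz = pr y z (adjacent q)
    cx≢cz : c x ≢ c z
    cx≢cz e = rot²≢ (c x) (trans e (trans (successor q) (cong rot (successor p))))
  Good⇒Colorful {c} {x} pr (inj₂ (y , z , p , q)) =
    y , z , ∼-sym (adjacent p) , ∼-sym (adjacent q)
    , (λ e → cx≢cy (cong c e)) , (λ e → cy≢cz (cong c e)) , (λ e → cx≢cz (cong c e))
    , cx≢cy , cy≢cz , cx≢cz
    where
    cx≢cy = pr x y (∼-sym (adjacent p))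
    cy≢cz = pr y z (∼-sym (adjacent q))
    cx≢cz : c x ≢ c z
    cx≢cz e = rot²≢ (c z) (trans (≡-sym e) (trans (successor p) (cong rot (successor q))))

  -- Reachability and rotation of colours

  data Reach (c : V → Fin 3) (r : V) : V → Set where
    done  : Reach c r r
    _then_ : ∀ {x y} → c ⊢ x ⟶ y → Reach c r y → Reach c r x

  -- When the colours in `D` are lowered by one, an edge entering `D` would become monochromatic;
  -- this condition excludes such edges.
  InClosed : (V → Fin 3) → (V → Set) → Set
  InClosed c D = ∀ {x y} → c ⊢ x ⟶ y → D y → D x

  module Rotate (c : V → Fin 3) (pr : Proper G 3 c)
                (D : V → Set) (D? : ∀ v → Dec (D v)) (closed : InClosed c D) where

    abstract
      rotate : V → Fin 3
      rotate v with D? v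
      ... | yes _ = rot (rot (c v))
      ... | no _  = c v

      rotate-in : ∀ {v} → D v → rotate v ≡ rot (rot (c v))
      rotate-in {v} v∈ with D? v
      ... | yes _ = refl
      ... | no v∉ = ⊥-elim (v∉ v∈)

      rotate-out : ∀ {v} → ¬ D v → rotate v ≡ c v
      rotate-out {v} v∉ with D? v
      ... | yes v∈ = ⊥-elim (v∉ v∈)
      ... | no _   = refl

    keep-in : ∀ {u v} → D u → D v → c ⊢ u ⟶ v → rotate ⊢ u ⟶ v
    keep-in u∈ v∈ (edge a e) = edge a
      (trans (rotate-in v∈) (trans (cong (λ k → rot (rot k)) e) (cong rot (≡-sym (rotate-in u∈)))))

    keep-out : ∀ {u v} → ¬ D u → ¬ D v → c ⊢ u ⟶ v → rotate ⊢ u ⟶ v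
    keep-out u∉ v∉ (edge a e) = edge a
      (trans (rotate-out v∉) (trans e (cong rot (≡-sym (rotate-out u∉)))))

    -- On an edge leaving `D`, the colours i and i + 1 become i + 2 and i + 1.
    flip : ∀ {u v} → D u → ¬ D v → c ⊢ u ⟶ v → rotate ⊢ v ⟶ u
    flip u∈ v∉ (edge a e) = edge (∼-sym a)
      (trans (rotate-in u∈) (cong rot (trans (≡-sym e) (≡-sym (rotate-out v∉)))))

    leaves : ∀ {u v} → ¬ D u → c ⊢ u ⟶ v → rotate ⊢ u ⟶ v
    leaves u∉ p = keep-out u∉ (λ v∈ → u∉ (closed p v∈)) p

    forward : ∀ {u v} → c ⊢ u ⟶ v → rotate ⊢ u ⟶ v ⊎ rotate ⊢ v ⟶ u
    forward {u} {v} p with D? u | D? v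
    ... | yes u∈ | yes v∈ = inj₁ (keep-in u∈ v∈ p)
    ... | yes u∈ | no v∉  = inj₂ (flip u∈ v∉ p)
    ... | no u∉  | _      = inj₁ (leaves u∉ p)

    rotate-proper : Proper G 3 rotate
    rotate-proper u v u∼v e with orient pr u∼v
    ... | inj₁ p with forward p
    ...   | inj₁ q = rot≢ (rotate u) (trans e (successor q))
    ...   | inj₂ q = rot≢ (rotate v) (trans (≡-sym e) (successor q))
    rotate-proper u v u∼v e | inj₂ p with forward p
    ...   | inj₁ q = rot≢ (rotate v) (trans (≡-sym e) (successor q))
    ...   | inj₂ q = rot≢ (rotate u) (trans e (successor q))

    backward : ∀ {u v} → rotate ⊢ u ⟶ v → c ⊢ u ⟶ v ⊎ (D v × ¬ D u × c ⊢ v ⟶ u)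
    backward {u} {v} q with orient pr (adjacent q)
    ... | inj₁ p = inj₁ p
    ... | inj₂ p with D? u | D? v
    ...   | yes u∈ | yes v∈ = ⊥-elim (⟶-asym q (keep-in v∈ u∈ p))
    ...   | yes u∈ | no v∉  = ⊥-elim (v∉ (closed p u∈))
    ...   | no u∉  | yes v∈ = inj₂ (v∈ , u∉ , p)
    ...   | no u∉  | no v∉  = ⊥-elim (⟶-asym q (keep-out v∉ u∉ p))

  -- Colourings in which every vertex reaches the root

  record State (r : V) : Set where
    field
      colour : V → Fin 3
      proper : Proper G 3 colour
      rooted : ∀ v → Reach colour r v

  open State public

  -- Induction backwards along the paths to the root. It serves to show that a configuration around
  -- the root is already the whole graph.
  sweep : ∀ {r} (s : State r) (P : V → Set) → P r →
          (∀ {x y} → colour s ⊢ x ⟶ y → P y → P x) → ∀ v → P v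
  sweep s P base up v = go (rooted s v)
    where
    go : ∀ {v} → Reach (colour s) _ v → P v
    go done       = base
    go (p then q) = up p (go q)

  exit : (D : V → Set) (D? : ∀ v → Dec (D v)) → ∀ {u v} → Walk G u v → D u → ¬ D v →
         ∃ λ x → ∃ λ y → x ∼ y × D x × ¬ D y
  exit D D? here u∈ v∉ = ⊥-elim (v∉ u∈)
  exit D D? (step {v = w} u∼w rest) u∈ v∉ with D? w
  ... | yes w∈ = exit D D? rest w∈ v∉
  ... | no w∉  = _ , w , u∼w , u∈ , w∉

  module _ (walks : ∀ u v → Walk G u v) where

    connected-closed : (D : V → Set) (D? : ∀ v → Dec (D v)) → ∀ {r} → D r →
                       (∀ {x y} → D x → x ∼ y → D y) → ∀ v → D v
    connected-closed D D? {r} r∈ cl v with D? v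
    ... | yes v∈ = v∈
    ... | no v∉ with exit D D? (walks r v) r∈ v∉
    ...   | _ , _ , x∼y , x∈ , y∉ = ⊥-elim (y∉ (cl x∈ x∼y))

    -- Rotating a set that no edge enters reverses its boundary, so the set of vertices
    -- that reach the root can always be enlarged.
    grow : ∀ {r} (R : Subset (n G)) → Acc _⊃_ R →
           (c : V → Fin 3) → Proper G 3 c → r ∈ R → (∀ v → v ∈ R → Reach c r v) → State r
    grow {r} R (acc larger) c pr r∈R reach with all? (λ v → v ∈? R)
    ... | yes all∈ = record { colour = c ; proper = pr ; rooted = λ v → reach v (all∈ v) }
    ... | no ¬all∈ with any? (λ u → any? (λ v → ¬? (u ∈? R) ×-dec ((v ∈? R) ×-dec (c ⊢ u ⟶? v))))
    ...   | yes (u , v , u∉R , v∈R , u⟶v) =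
            grow (R ∪ ⁅ u ⁆) (larger (p⊆p∪q ⁅ u ⁆ , u , q⊆p∪q R ⁅ u ⁆ (x∈⁅x⁆ u) , u∉R))
                 c pr (p⊆p∪q ⁅ u ⁆ r∈R) reach+
            where
            reach+ : ∀ w → w ∈ R ∪ ⁅ u ⁆ → Reach c r w
            reach+ w w∈ with x∈p∪q⁻ R ⁅ u ⁆ w∈
            ... | inj₁ w∈R = reach w w∈R
            ... | inj₂ w∈u with refl ← x∈⁅y⁆⇒x≡y u w∈u = u⟶v then reach v v∈R
    ...   | no none with ¬∀⟶∃¬ _ _ (λ v → v ∈? R) ¬all∈
    ...     | w , w∉R with exit (_∈ R) (λ v → v ∈? R) (walks r w) r∈R w∉R
    ...       | v , u , v∼u , v∈R , u∉R =
            grow (R ∪ ⁅ u ⁆) (larger (p⊆p∪q ⁅ u ⁆ , u , q⊆p∪q R ⁅ u ⁆ (x∈⁅x⁆ u) , u∉R))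
                 rotate rotate-proper (p⊆p∪q ⁅ u ⁆ r∈R) reach+
            where
            closed : InClosed c (_∈ R)
            closed {x} {y} p y∈R = decidable-stable (x ∈? R) (λ x∉R → none (x , y , x∉R , y∈R , p))
            open Rotate c pr (_∈ R) (λ v → v ∈? R) closed
            inside-R : ∀ {w} → Reach c r w → w ∈ R
            inside-R done       = r∈R
            inside-R (p then q) = closed p (inside-R q)
            still : ∀ {w} → Reach c r w → Reach rotate r w
            still done       = done
            still (p then q) = keep-in (closed p (inside-R q)) (inside-R q) p then still q
            v⟶u : c ⊢ v ⟶ u
            v⟶u with orient pr v∼u
            ... | inj₁ p = p
            ... | inj₂ p = ⊥-elim (u∉R (closed p v∈R))
            reach+ : ∀ w → w ∈ R ∪ ⁅ u ⁆ → Reach rotate r w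
            reach+ w w∈ with x∈p∪q⁻ R ⁅ u ⁆ w∈
            ... | inj₁ w∈R = still (reach w w∈R)
            ... | inj₂ w∈u with refl ← x∈⁅y⁆⇒x≡y u w∈u = flip v∈R u∉R v⟶u then still (reach v v∈R)

    abstract
      root : ∀ r c → Proper G 3 c → State r
      root r c pr = grow ⁅ r ⁆ (⊃-wellFounded ⁅ r ⁆) c pr (x∈⁅x⁆ r) λ v v∈ → start (x∈⁅y⁆⇒x≡y r v∈)
        where
        start : ∀ {v} → v ≡ r → Reach c r v
        start refl = done

  -- Blocked vertices in a counterexample

  module Counterexample
    (walks   : ∀ u v → Walk G u v)
    (not-2   : ¬ Colorable G 2)
    (no-good : ∀ c → Proper G 3 c → ¬ (∀ x → Good c x)) where

    -- Merging the two colours other than `k` would give a proper 2-colouring.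
    no-majority : ∀ (c : V → Fin 3) k → (∀ {u v} → c u ≢ k → c v ≢ k → ¬ (u ∼ v)) →
                  Proper G 3 c → ⊥
    no-majority c k indep pr = not-2 (two , two-proper)
      where
      two : V → Fin 2
      two v with c v ≟ k
      ... | yes _ = zero
      ... | no _  = suc zero
      two-proper : Proper G 2 two
      two-proper u v u∼v e with c u ≟ k | c v ≟ k | e
      ... | yes p | yes q | _  = pr u v u∼v (trans p (≡-sym q))
      ... | yes p | no q  | ()
      ... | no p  | yes q | ()
      ... | no p  | no q  | _  = indep p q u∼v

    module _ {r} (s : State r) where

      private c = colour s

      exit-or-root : ∀ v → v ≡ r ⊎ ∃ λ w → c ⊢ v ⟶ w
      exit-or-root v with rooted s v
      ... | done     = inj₁ refl
      ... | p then _ = inj₂ (_ , p)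

      -- All other vertices have an out-neighbour on their way to the root. If the root had one too,
      -- two steps forward from any vertex would make it good.
      sink : ∀ {w} → ¬ (c ⊢ r ⟶ w)
      sink {w} r⟶w = no-good c (proper s) good
        where
        out : ∀ v → ∃ λ w → c ⊢ v ⟶ w
        out v with exit-or-root v
        ... | inj₁ refl = w , r⟶w
        ... | inj₂ p    = p
        good : ∀ v → Good c v
        good v with out v
        ... | y , p with out y
        ...   | z , q = inj₁ (y , z , p , q)

      out : ∀ {v} → v ≢ r → ∃ λ w → c ⊢ v ⟶ w
      out {v} v≢r with exit-or-root v
      ... | inj₁ e = ⊥-elim (v≢r e)
      ... | inj₂ p = p

      into-root : ∀ {v} → v ∼ r → c ⊢ v ⟶ r
      into-root v∼r with orient (proper s) v∼r
      ... | inj₁ p = p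
      ... | inj₂ p = ⊥-elim (sink p)

      -- The explicit form of not being good, by `Blocked⇒¬Good` and `¬Good⇒Blocked`.
      record Blocked (b : V) : Set where
        field
          to-root : c ⊢ b ⟶ r
          only    : ∀ {u} → c ⊢ b ⟶ u → u ≡ r
          source  : ∀ {a w} → c ⊢ a ⟶ b → ¬ (c ⊢ w ⟶ a)

      open Blocked public

      Blocked⇒¬Good : ∀ {b} → Blocked b → ¬ Good c b
      Blocked⇒¬Good B (inj₁ (y , z , p , q)) with refl ← only B p = sink q
      Blocked⇒¬Good B (inj₂ (y , z , p , q)) = source B p q

      -- If no directed path of length two ended in `r`, the graph would be a star centred at `r`,
      -- hence 2-colourable.
      root-Good : Good c r
      root-Good = decidable-stable (Good? c r) contradict
        where
        contradict : ¬ ¬ Good c r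
        contradict bad = no-majority c (rot (rot (c r)))
            (λ p q u∼v → proper s _ _ u∼v (cong c (trans (only-root p) (≡-sym (only-root q)))))
            (proper s)
          where
          near : ∀ v → v ≡ r ⊎ c ⊢ v ⟶ r
          near = sweep s (λ v → v ≡ r ⊎ c ⊢ v ⟶ r) (inj₁ refl) λ where
            p (inj₁ refl) → inj₂ p
            p (inj₂ q)    → ⊥-elim (bad (inj₂ (_ , _ , q , p)))
          only-root : ∀ {v} → c v ≢ rot (rot (c r)) → v ≡ r
          only-root {v} cv≢ with near v
          ... | inj₁ e = e
          ... | inj₂ p = ⊥-elim (cv≢ (≡-sym (trans (cong (λ k → rot (rot k)) (successor p)) (rot³ (c v)))))

      ¬Good⇒Blocked : ∀ {b} → ¬ Good c b → Blocked b
      ¬Good⇒Blocked {b} bad = record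
        { to-root = subst (c ⊢ b ⟶_) (ends (proj₂ b-out)) (proj₂ b-out)
        ; only    = ends
        ; source  = λ p q → bad (inj₂ (_ , _ , p , q))
        }
        where
        ends : ∀ {u} → c ⊢ b ⟶ u → u ≡ r
        ends {u} p with exit-or-root u
        ... | inj₁ e       = e
        ... | inj₂ (w , q) = ⊥-elim (bad (inj₁ (u , w , p , q)))
        b-out : ∃ λ w → c ⊢ b ⟶ w
        b-out = out λ { refl → bad root-Good }

      Blocked? : ∀ b → Dec (Blocked b)
      Blocked? b = map′ ¬Good⇒Blocked Blocked⇒¬Good (¬? (Good? c b))

      abstract
        blocked-exists : ∃ Blocked
        blocked-exists with ¬∀⟶∃¬ _ _ (Good? c) (no-good c (proper s))
        ... | b , bad = b , ¬Good⇒Blocked bad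

    -- The vertices not coloured like `b` are then `r` and in-neighbours of `b`. The latter share a
    -- colour, and none is adjacent to `r`, since its edge to `r` would be a shortcut past `b`. So
    -- `no-majority` applies.
    no-cone : ∀ {r b} (s : State r) → colour s ⊢ b ⟶ r →
              (∀ v → v ≡ r ⊎ colour s ⊢ v ⟶ b ⊎ colour s ⊢ v ⟶ r) → ⊥
    no-cone {r} {b} s b⟶r shape = no-majority c (c b) indep (proper s)
      where
      c = colour s
      minority : ∀ {v} → c v ≢ c b → v ≡ r ⊎ c ⊢ v ⟶ b
      minority {v} cv≢ with shape v
      ... | inj₁ e        = inj₁ e
      ... | inj₂ (inj₁ p) = inj₂ p
      ... | inj₂ (inj₂ p) = ⊥-elim (cv≢ (rot-injective (trans (≡-sym (successor p)) (successor b⟶r))))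
      indep : ∀ {u v} → c u ≢ c b → c v ≢ c b → ¬ (u ∼ v)
      indep p q u∼v with minority p | minority q
      ... | inj₁ refl | inj₁ refl = proper s _ _ u∼v refl
      ... | inj₁ refl | inj₂ v⟶b  = no-shortcut v⟶b b⟶r (into-root s (∼-sym u∼v))
      ... | inj₂ u⟶b  | inj₁ refl = no-shortcut u⟶b b⟶r (into-root s u∼v)
      ... | inj₂ u⟶b  | inj₂ v⟶b  = proper s _ _ u∼v
        (rot-injective (trans (≡-sym (successor u⟶b)) (successor v⟶b)))

    -- Moving the root

    module Shift {r} (s : State r) (z : V) (z⟶r : colour s ⊢ z ⟶ r)
                 (sources : ∀ {a w} → colour s ⊢ a ⟶ z → ¬ (colour s ⊢ w ⟶ a)) where

      private c = colour s

      Tail : V → Set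
      Tail v = v ≡ z ⊎ c ⊢ v ⟶ z

      Tail? : ∀ v → Dec (Tail v)
      Tail? v = (v ≟ z) ⊎-dec (c ⊢ v ⟶? z)

      Tail-closed : InClosed c Tail
      Tail-closed p (inj₁ refl) = inj₂ p
      Tail-closed p (inj₂ q)    = ⊥-elim (sources q p)

      root∉Tail : ¬ Tail r
      root∉Tail (inj₁ refl) = ⟶-irrefl z⟶r
      root∉Tail (inj₂ p)    = sink s p

      open Rotate c (proper s) Tail Tail? Tail-closed public

      -- A path to the old root is cut where it first meets `Tail`, from which `z` is at most one
      -- step away. A path that misses `Tail` is completed by the reversed edge from `r` to `z`.
      reach : ∀ {v} → Reach c r v → Reach rotate z v
      reach done = flip (inj₁ refl) root∉Tail z⟶r then done
      reach {v} (p then q) with Tail? v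
      ... | yes (inj₁ refl) = done
      ... | yes (inj₂ v⟶z)  = keep-in (inj₂ v⟶z) (inj₁ refl) v⟶z then done
      ... | no v∉           = leaves v∉ p then reach q

      state : State z
      state = record { colour = rotate ; proper = rotate-proper ; rooted = λ v → reach (rooted s v) }

    advance : ∀ {r b} (s : State r) → Blocked s b → State b
    advance s B = Shift.state s _ (to-root B) (source B)

    module Advance {r b} (s : State r) (B : Blocked s b) where

      private c = colour s
      open Shift s b (to-root B) (source B) public

      -- If `r` were blocked, its in-neighbours other than `b` would be sources after the rotation,
      -- so before it they had in-neighbours in `Tail` only. That leaves a graph excluded by
      -- `no-cone`.
      old-root-Good : ¬ Blocked state r
      old-root-Good R = no-cone s (to-root B) (sweep s Shape (inj₁ refl) up)
        where
        Shape : V → Set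
        Shape v = v ≡ r ⊎ c ⊢ v ⟶ b ⊎ c ⊢ v ⟶ r
        up : ∀ {x y} → c ⊢ x ⟶ y → Shape y → Shape x
        up p (inj₁ refl)        = inj₂ (inj₂ p)
        up p (inj₂ (inj₁ y⟶b)) = ⊥-elim (source B y⟶b p)
        up {x} {y} p (inj₂ (inj₂ y⟶r)) with y ≟ b | Tail? x
        ... | yes refl | _               = inj₂ (inj₁ p)
        ... | no y≢b   | yes (inj₂ x⟶b)  = inj₂ (inj₁ x⟶b)
        ... | no y≢b   | yes (inj₁ refl) with refl ← only B p = ⊥-elim (⟶-irrefl y⟶r)
        up {x} {y} p (inj₂ (inj₂ y⟶r)) | no y≢b | no x∉ =
          ⊥-elim (source R (leaves (λ y∈ → x∉ (Tail-closed p y∈)) y⟶r) (leaves x∉ p))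

      -- The only edge leaving `b` goes to `r`, and `r` is not blocked in the new state.
      next-in : ∀ {a} → Blocked state a → c ⊢ a ⟶ b
      next-in A with orient (proper s) (adjacent (to-root A))
      ... | inj₁ p = p
      ... | inj₂ p with refl ← only B p = ⊥-elim (old-root-Good A)

      -- After the rotation `z` points to the blocked vertex `a` and so is a source. Every edge into
      -- `z` must therefore have been reversed, which places its tail in `Tail`; that tail is not
      -- `b`, because otherwise `z` would be `r` and the edge from `a` a shortcut.
      next-neighbour : ∀ {a z} → Blocked state a → c ⊢ a ⟶ z → z ≢ b → ∀ {x} → c ⊢ x ⟶ z → c ⊢ x ⟶ b
      next-neighbour {a} {z} A a⟶z z≢b {x} x⟶z with Tail? x
      ... | yes (inj₁ refl) with refl ← only B x⟶z = ⊥-elim (no-shortcut (next-in A) (to-root B) a⟶z)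
      ... | yes (inj₂ p)    = p
      ... | no x∉           = ⊥-elim (source A z⟶a (leaves x∉ x⟶z))
        where
        z⟶a : rotate ⊢ z ⟶ a
        z⟶a = flip (inj₂ (next-in A)) (λ z∈ → x∉ (Tail-closed x⟶z z∈)) a⟶z

    -- Move the root to `z` instead of `b`. An in-neighbour `a` of `b` that does not point to `z`
    -- keeps its edge to `b`. Then no vertex is blocked: old in-neighbours of `z`, and `r`, end a
    -- path through `a` and `b`, while any other out-neighbour of `z` keeps an out-neighbour
    -- different from `z`.
    antichain : ∀ {r b z} (s : State r) → Blocked s b → colour s ⊢ z ⟶ r →
                (∀ {x} → colour s ⊢ x ⟶ z → colour s ⊢ x ⟶ b) →
                ∀ {x} → colour s ⊢ x ⟶ b → colour s ⊢ x ⟶ z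
    antichain {r} {b} {z} s B z⟶r sub {a} a⟶b = decidable-stable (c ⊢ a ⟶? z) contradict
      where
      c = colour s
      open Shift s z z⟶r (λ p → source B (sub p))
      contradict : ¬ ¬ (c ⊢ a ⟶ z)
      contradict a↛z with blocked-exists state
      ... | y , Y = impossible (backward (to-root Y))
        where
        b∉ : ¬ Tail b
        b∉ (inj₁ refl) = a↛z a⟶b
        b∉ (inj₂ b⟶z) with refl ← only B b⟶z = ⟶-irrefl z⟶r
        a∉ : ¬ Tail a
        a∉ (inj₁ refl) = no-shortcut a⟶b (to-root B) z⟶r
        a∉ (inj₂ a⟶z)  = a↛z a⟶z
        impossible : ¬ (c ⊢ y ⟶ z ⊎ (Tail z × ¬ Tail y × c ⊢ z ⟶ y))
        impossible (inj₁ y⟶z) = source Y (flip (inj₂ y⟶z) b∉ (sub y⟶z)) (leaves a∉ a⟶b)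
        impossible (inj₂ (_ , y∉ , z⟶y)) with exit-or-root s y
        ... | inj₁ refl      = source Y (leaves b∉ (to-root B)) (leaves a∉ a⟶b)
        ... | inj₂ (w , y⟶w) with refl ← only Y (leaves y∉ y⟶w) = ⟶-asym z⟶y y⟶w

    -- In-neighbourhoods and twins

    SameIn : ∀ {r} → State r → V → V → Set
    SameIn s b b′ = ∀ x → (colour s ⊢ x ⟶ b → colour s ⊢ x ⟶ b′)
                        × (colour s ⊢ x ⟶ b′ → colour s ⊢ x ⟶ b)

    SameIn? : ∀ {r} (s : State r) b b′ → Dec (SameIn s b b′)
    SameIn? s b b′ = all? λ x →
      ((colour s ⊢ x ⟶? b) →-dec (colour s ⊢ x ⟶? b′)) ×-dec
      ((colour s ⊢ x ⟶? b′) →-dec (colour s ⊢ x ⟶? b))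

    SameIn-sym : ∀ {r} {s : State r} {b b′} → SameIn s b b′ → SameIn s b′ b
    SameIn-sym e x = proj₂ (e x) , proj₁ (e x)

    SameIn-trans : ∀ {r} {s : State r} {b b′ b″} → SameIn s b b′ → SameIn s b′ b″ → SameIn s b b″
    SameIn-trans e f x = (λ p → proj₁ (f x) (proj₁ (e x) p)) , (λ p → proj₂ (e x) (proj₂ (f x) p))

    -- Stated with undirected adjacency, so that it carries over between states.
    Twin : V → V → Set
    Twin x y = ∀ w → (x ∼ w → y ∼ w) × (y ∼ w → x ∼ w)

    Twin-sym : ∀ {x y} → Twin x y → Twin y x
    Twin-sym t w = proj₂ (t w) , proj₁ (t w)

    Twin-trans : ∀ {x y z} → Twin x y → Twin y z → Twin x z
    Twin-trans t u w = (λ p → proj₁ (u w) (proj₁ (t w) p)) , (λ p → proj₂ (t w) (proj₂ (u w) p))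

    private-in : ∀ {r b a b′} (s : State r) (B : Blocked s b) → Blocked (advance s B) a →
                 Blocked s b′ → colour s ⊢ a ⟶ b′ → SameIn s b b′
    private-in {b = b} {b′ = b′} s B A B′ a⟶b′ with b′ ≟ b
    ... | yes refl = λ x → (λ p → p) , (λ p → p)
    ... | no b′≢b  = λ x → antichain s B (to-root B′) sub , sub
      where
      sub : ∀ {x} → colour s ⊢ x ⟶ b′ → colour s ⊢ x ⟶ b
      sub = Advance.next-neighbour s B A a⟶b′ b′≢b

    -- After the first move, all neighbours of `x` and `a` except the common neighbour `b` are
    -- in-neighbours. It is thus enough to compare in-neighbourhoods there: `next-neighbour` for the
    -- second move gives one inclusion and `antichain` the other.
    twins-in : ∀ {r b a z} (s : State r) (B : Blocked s b) (A : Blocked (advance s B) a) →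
               Blocked (advance (advance s B) A) z →
               ∀ {x} → colour s ⊢ x ⟶ z → colour s ⊢ x ⟶ b → Twin x a
    twins-in {b = b} {a = a} {z = z} s B A Z {x} x⟶z x⟶b with x ≟ a
    ... | yes refl = λ w → (λ p → p) , (λ p → p)
    ... | no x≢a   = twin
      where
      c = colour s
      s₁ = advance s B
      module S₁ = Advance s B
      module S₂ = Advance s₁ A
      z⟶₁a : colour s₁ ⊢ z ⟶ a
      z⟶₁a = S₂.next-in Z
      z≢b : z ≢ b
      z≢b refl = sink s₁ z⟶₁a
      z∉ : ¬ S₁.Tail z
      z∉ (inj₁ z≡b) = z≢b z≡b
      z∉ (inj₂ z⟶b) = source B z⟶b x⟶z
      sub : ∀ {w} → colour s₁ ⊢ w ⟶ x → colour s₁ ⊢ w ⟶ a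
      sub = S₂.next-neighbour Z (S₁.flip (inj₂ x⟶b) z∉ x⟶z) x≢a
      inward : ∀ {t w} → c ⊢ t ⟶ b → t ∼ w → w ≢ b → colour s₁ ⊢ w ⟶ t
      inward t⟶b t∼w w≢b with orient (proper s) t∼w
      ... | inj₁ t⟶w = S₁.flip (inj₂ t⟶b)
                         (λ { (inj₁ e) → w≢b e ; (inj₂ w⟶b) → source B w⟶b t⟶w }) t⟶w
      ... | inj₂ w⟶t = ⊥-elim (source B t⟶b w⟶t)
      a⟶b : c ⊢ a ⟶ b
      a⟶b = S₁.next-in A
      twin : Twin x a
      twin w with w ≟ b
      ... | yes refl = (λ _ → adjacent a⟶b) , (λ _ → adjacent x⟶b)
      ... | no w≢b   =
        (λ p → ∼-sym (adjacent (sub (inward x⟶b p w≢b)))) ,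
        (λ p → ∼-sym (adjacent (antichain s₁ A (S₁.keep-in (inj₂ x⟶b) (inj₁ refl) x⟶b) sub
                                  (inward a⟶b p w≢b))))

    -- What is needed to repair `b` by rotating `z` with its in-neighbours. The fields `twin` and
    -- `owner` prevent repairs for different in-neighbourhoods from interfering.
    record Key {r} (s : State r) (b z : V) : Set where
      field
        {a}   : V
        a⟶z   : colour s ⊢ a ⟶ z
        sub   : ∀ {x} → colour s ⊢ x ⟶ z → colour s ⊢ x ⟶ b
        twin  : ∀ {x} → colour s ⊢ x ⟶ z → Twin x a
        owner : ∀ {b′} → Blocked s b′ → colour s ⊢ a ⟶ b′ → SameIn s b b′

    abstract
      -- The next two blocked vertices `a` and `z` serve. In the intermediate state `z` points to
      -- `a`; as `a` is a source in `s`, this edge was reversed by the first move.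
      key : ∀ {r b} (s : State r) → Blocked s b → ∃ (Key s b)
      key {b = b} s B with blocked-exists (advance s B)
      ... | a , A with blocked-exists (advance (advance s B) A)
      ...   | z , Z = z , record
          { a⟶z   = a⟶z
          ; sub   = sub
          ; twin  = λ p → twins-in s B A Z p (sub p)
          ; owner = private-in s B A
          }
        where
        module S₁ = Advance s B
        module S₂ = Advance S₁.state A
        z⟶₁a : colour S₁.state ⊢ z ⟶ a
        z⟶₁a = S₂.next-in Z
        z≢b : z ≢ b
        z≢b refl = sink S₁.state z⟶₁a
        a⟶z : colour s ⊢ a ⟶ z
        a⟶z with S₁.backward z⟶₁a
        ... | inj₁ z⟶a           = ⊥-elim (source B (S₁.next-in A) z⟶a)
        ... | inj₂ (_ , _ , a⟶z) = a⟶z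
        sub : ∀ {x} → colour s ⊢ x ⟶ z → colour s ⊢ x ⟶ b
        sub = S₁.next-neighbour A a⟶z z≢b

    -- Simultaneous repair of all blocked vertices

    -- Choosing one blocked vertex per in-neighbourhood keeps the chosen sets of sources
    -- disjoint, so all blocked vertices can be repaired at once.
    module Repair {r} (s : State r) (keys : ∀ b → ∃ λ z → Blocked s b → Key s b z)
      (spare : ∀ b → Blocked s b → ∃ λ a → colour s ⊢ a ⟶ b × ¬ (colour s ⊢ a ⟶ proj₁ (keys b)))
      where

      private
        c = colour s
        ζ : V → V
        ζ b = proj₁ (keys b)

      Leader : V → Set
      Leader b = Blocked s b × ∀ b′ → b′ < b → ¬ (Blocked s b′ × SameIn s b′ b)

      Leader? : ∀ b → Dec (Leader b)
      Leader? b = Blocked? s b ×-dec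
        all? (λ b′ → (b′ <? b) →-dec ¬? (Blocked? s b′ ×-dec SameIn? s b′ b))

      leader : ∀ {b} → Blocked s b → ∃ λ ℓ → Leader ℓ × SameIn s ℓ b
      leader {b} = go (<-wellFounded b)
        where
        go : ∀ {b} → Acc _<_ b → Blocked s b → ∃ λ ℓ → Leader ℓ × SameIn s ℓ b
        go {b} (acc below) B
          with any? (λ b′ → (b′ <? b) ×-dec (Blocked? s b′ ×-dec SameIn? s b′ b))
        ... | no none = b , (B , λ b′ b′<b q → none (b′ , b′<b , q)) , λ x → (λ p → p) , (λ p → p)
        ... | yes (b′ , b′<b , B′ , same) with go (below b′<b) B′
        ...   | ℓ , L , same′ = ℓ , L , SameIn-trans {s = s} same′ same

      leader-unique : ∀ {b b′} → Leader b → Leader b′ → SameIn s b b′ → b ≡ b′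
      leader-unique {b} {b′} (B , least) (B′ , least′) same with <-cmp b b′
      ... | tri< lt _ _ = ⊥-elim (least′ b lt (B , same))
      ... | tri≈ _ e _  = e
      ... | tri> _ _ gt = ⊥-elim (least b′ gt (B′ , SameIn-sym {s = s} same))

      keyOf : ∀ {b} → Leader b → Key s b (ζ b)
      keyOf {b} (B , _) = proj₂ (keys b) B

      D : V → Set
      D v = ∃ λ b → Leader b × (v ≡ ζ b ⊎ c ⊢ v ⟶ ζ b)

      D? : ∀ v → Dec (D v)
      D? v = any? λ b → Leader? b ×-dec ((v ≟ ζ b) ⊎-dec (c ⊢ v ⟶? ζ b))

      D-closed : InClosed c D
      D-closed p (b , L , inj₁ refl) = b , L , inj₂ p
      D-closed p (b , L , inj₂ q)    = ⊥-elim (source (proj₁ L) (Key.sub (keyOf L) q) p)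

      open Rotate c (proper s) D D? D-closed

      root∉ : ¬ D r
      root∉ (b , L , inj₁ e) = no-shortcut (Key.sub K (Key.a⟶z K)) (to-root (proj₁ L))
        (subst (c ⊢ Key.a K ⟶_) (≡-sym e) (Key.a⟶z K))
        where K = keyOf L
      root∉ (b , L , inj₂ p) = sink s p

      -- By `owner`, a blocked key vertex would have the in-neighbourhood of its leader, spare
      -- vertex included. A blocked in-neighbour of a key vertex would be a source, although its own
      -- spare vertex points to it.
      blocked∉ : ∀ {b} → Blocked s b → ¬ D b
      blocked∉ {b} B (b′ , L , inj₁ refl) with spare b′ (proj₁ L)
      ... | a , a⟶b′ , a↛z = a↛z (proj₁ (Key.owner K B (Key.a⟶z K) a) a⟶b′)
        where K = keyOf L
      blocked∉ {b} B (b′ , L , inj₂ p) with spare b B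
      ... | a , a⟶b , _ = source (proj₁ L) (Key.sub (keyOf L) p) a⟶b

      -- A spare vertex rotated for a leader `b` would be a twin of the vertex `Key.a` of `b`, which
      -- then also points to `ℓ`. By `owner` and uniqueness of leaders, `b` is `ℓ`.
      spare∉ : ∀ {ℓ a} → Leader ℓ → c ⊢ a ⟶ ℓ → ¬ (c ⊢ a ⟶ ζ ℓ) → ¬ D a
      spare∉ L a⟶ℓ a↛z (b , L′ , inj₁ refl) = source (proj₁ L) a⟶ℓ (Key.a⟶z (keyOf L′))
      spare∉ {ℓ} {a} L a⟶ℓ a↛z (b , L′ , inj₂ a⟶z) = a↛z (subst (λ t → c ⊢ a ⟶ ζ t) b≡ℓ a⟶z)
        where
        K = keyOf L′
        a₀⟶ℓ : c ⊢ Key.a K ⟶ ℓ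
        a₀⟶ℓ = edge (proj₁ (Key.twin K a⟶z ℓ) (adjacent a⟶ℓ))
          (trans (successor a⟶ℓ) (rot-same (Key.sub K a⟶z) (Key.sub K (Key.a⟶z K))))
          where
          rot-same : ∀ {u v w} → c ⊢ u ⟶ w → c ⊢ v ⟶ w → rot (c u) ≡ rot (c v)
          rot-same p q = trans (≡-sym (successor p)) (successor q)
        b≡ℓ : b ≡ ℓ
        b≡ℓ = leader-unique L′ L (Key.owner K (proj₁ L) a₀⟶ℓ)

      spare-in : ∀ {ℓ} → Leader ℓ → ∃ λ a → rotate ⊢ a ⟶ ℓ
      spare-in {ℓ} L with spare ℓ (proj₁ L)
      ... | a , a⟶ℓ , a↛z = a , leaves (spare∉ L a⟶ℓ a↛z) a⟶ℓ

      key-edge : ∀ {ℓ a} → Leader ℓ → c ⊢ a ⟶ ζ ℓ → rotate ⊢ a ⟶ ζ ℓ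
      key-edge {ℓ} L p = keep-in (ℓ , L , inj₂ p) (ℓ , L , inj₁ refl) p

      source-edge : ∀ {ℓ a} → Leader ℓ → c ⊢ a ⟶ ζ ℓ → rotate ⊢ ℓ ⟶ a
      source-edge {ℓ} L p = flip (ℓ , L , inj₂ p) (blocked∉ (proj₁ L)) (Key.sub (keyOf L) p)

      -- The rotation creates directed paths of length three: from a spare vertex to `ℓ`, then to an
      -- in-neighbour of `ζ ℓ`, then to `ζ ℓ`.
      good-D : ∀ {v} → D v → Good rotate v
      good-D (ℓ , L , inj₁ refl) = inj₂ (Key.a K , ℓ , key-edge L (Key.a⟶z K) , source-edge L (Key.a⟶z K))
        where K = keyOf L
      good-D (ℓ , L , inj₂ v⟶z) with spare-in L
      ... | a , a⟶ℓ = inj₂ (ℓ , a , source-edge L v⟶z , a⟶ℓ)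

      good-blocked : ∀ {b} → Blocked s b → Good rotate b
      good-blocked {b} B with leader B
      ... | ℓ , L , same =
        inj₁ (Key.a K , ζ ℓ , flip (ℓ , L , inj₂ (Key.a⟶z K)) (blocked∉ B) a⟶b , key-edge L (Key.a⟶z K))
        where
        K = keyOf L
        a⟶b : c ⊢ Key.a K ⟶ b
        a⟶b = proj₁ (same (Key.a K)) (Key.sub K (Key.a⟶z K))

      good-root : Good rotate r
      good-root with blocked-exists s
      ... | b , B with leader B
      ...   | ℓ , L , _ with spare-in L
      ...     | a , a⟶ℓ = inj₂ (ℓ , a , leaves (blocked∉ (proj₁ L)) (to-root (proj₁ L)) , a⟶ℓ)

      two-below-root : ∀ {ℓ a} → Leader ℓ → c ⊢ a ⟶ ζ ℓ → c r ≡ rot (rot (c a))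
      two-below-root L a⟶z =
        trans (successor (to-root (proj₁ L))) (cong rot (successor (Key.sub (keyOf L) a⟶z)))

      -- Key vertices are one colour below `r` and their in-neighbours two below. Here `t` has the
      -- colour of `r`, so it is not rotated, and `u` is two below, so it is not a key vertex. If
      -- `u` is rotated, the reversed edge starts a path from `v` through `u` to a key vertex.
      good-in : ∀ {v u t} → ¬ D v → c ⊢ v ⟶ r → c ⊢ u ⟶ v → c ⊢ t ⟶ u → Good rotate v
      good-in {v} {u} {t} v∉ v⟶r u⟶v t⟶u with D? u
      ... | no u∉ = inj₂ (u , t , leaves u∉ u⟶v , leaves t∉ t⟶u)
        where
        cr≡ct : c r ≡ c t
        cr≡ct = trans (successor v⟶r) (trans (cong rot (successor u⟶v))
          (trans (cong (λ k → rot (rot k)) (successor t⟶u)) (rot³ (c t))))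
        t∉ : ¬ D t
        t∉ (ℓ , L , inj₂ t⟶z) = rot²≢ (c t) (trans (≡-sym cr≡ct) (two-below-root L t⟶z))
        t∉ (ℓ , L , inj₁ refl) = rot≢ (rot (c (Key.a K)))
          (trans (≡-sym (successor (Key.a⟶z K))) (trans (≡-sym cr≡ct) (two-below-root L (Key.a⟶z K))))
          where K = keyOf L
      ... | yes (ℓ , L , inj₂ u⟶z) = inj₁ (u , ζ ℓ , flip (ℓ , L , inj₂ u⟶z) v∉ u⟶v , key-edge L u⟶z)
      ... | yes (ℓ , L , inj₁ refl) = ⊥-elim (rot²≢ (c (Key.a K))
          (trans (≡-sym (rot³ (c (Key.a K)))) (trans (≡-sym cr) (two-below-root L (Key.a⟶z K)))))
        where
        K = keyOf L
        cr : c r ≡ rot (rot (rot (c (Key.a K))))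
        cr = trans (successor v⟶r) (cong rot (trans (successor u⟶v) (cong rot (successor (Key.a⟶z K)))))

      all-good : ∀ v → Good rotate v
      all-good v with D? v | v ≟ r | Good? c v
      ... | yes v∈ | _        | _ = good-D v∈
      ... | no v∉  | yes v≡r  | _ = subst (Good rotate) (≡-sym v≡r) good-root
      ... | no v∉  | no v≢r   | no bad = good-blocked (¬Good⇒Blocked s bad)
      ... | no v∉  | no v≢r   | yes (inj₁ (y , z , p , q)) =
        inj₁ (y , z , leaves v∉ p , leaves (λ y∈ → v∉ (D-closed p y∈)) q)
      -- Edges out of `v` survive, whereas edges into it may be reversed. The incoming path is
      -- therefore used only if the way out stops at the root.
      ... | no v∉  | no v≢r   | yes (inj₂ (u , t , p , q)) with out s v≢r
      ...   | w , v⟶w with exit-or-root s w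
      ...     | inj₁ w≡r       = good-in v∉ (subst (c ⊢ v ⟶_) w≡r v⟶w) p q
      ...     | inj₂ (x , w⟶x) = inj₁ (w , x , leaves v∉ v⟶w , leaves (λ w∈ → v∉ (D-closed v⟶w w∈)) w⟶x)

      contradiction : ⊥
      contradiction = no-good rotate rotate-proper all-good

    -- Blocked vertices with twin in-neighbours

    record Thin {r} (s : State r) (b : V) : Set where
      field
        blocked : Blocked s b
        twins   : ∀ {x y} → colour s ⊢ x ⟶ b → colour s ⊢ y ⟶ b → Twin x y

    open Thin public

    abstract
      -- `Repair` transports along equalities of leaders, so the key vertex has to depend on `b`
      -- alone and not on a proof that `b` is blocked. For other vertices, `b` itself is an
      -- arbitrary default.
      choose-keys : ∀ {r} (s : State r) b → ∃ λ z → Blocked s b → Key s b z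
      choose-keys s b with Blocked? s b
      ... | yes B = let z , K = key s B in z , λ _ → K
      ... | no ¬B = b , λ B → ⊥-elim (¬B B)

    abstract
      -- Unless all in-neighbours of some blocked `b` point to its key vertex, and are then twins by
      -- `Key.twin`, every blocked vertex has the spare in-neighbour that `Repair` asks for.
      thin-exists : ∀ {r} (s : State r) → ∃ (Thin s)
      thin-exists s with any? (λ b → Blocked? s b ×-dec full? b)
        where
        full? : ∀ b → Dec (∀ x → colour s ⊢ x ⟶ b → colour s ⊢ x ⟶ proj₁ (choose-keys s b))
        full? b = all? λ x → (colour s ⊢ x ⟶? b) →-dec (colour s ⊢ x ⟶? proj₁ (choose-keys s b))
      ... | yes (b , B , full) = b , record
            { blocked = B
            ; twins   = λ p q → Twin-trans (Key.twin K (full _ p)) (Twin-sym (Key.twin K (full _ q)))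
            }
            where
            K : Key s b (proj₁ (choose-keys s b))
            K = proj₂ (choose-keys s b) B
      ... | no none = ⊥-elim (Repair.contradiction s (choose-keys s) spare)
        where
        spare : ∀ b → Blocked s b →
                ∃ λ a → colour s ⊢ a ⟶ b × ¬ (colour s ⊢ a ⟶ proj₁ (choose-keys s b))
        spare b B with any? (λ a → (colour s ⊢ a ⟶? b) ×-dec ¬? (colour s ⊢ a ⟶? proj₁ (choose-keys s b)))
        ... | yes found = found
        ... | no ¬found = ⊥-elim (none (b , B , λ x p →
          decidable-stable (colour s ⊢ x ⟶? proj₁ (choose-keys s b)) λ q → ¬found (x , p , q)))

    -- A second in-neighbour `t` would be a twin of `a`, hence adjacent to the thin vertex `z` found
    -- after two moves. This makes all neighbours of `z` twins of `y`. With the root at `z`,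
    -- whatever points to an in-neighbour of `z` is then `z` or points to `y`, which `no-cone`
    -- excludes.
    unique-in : ∀ {r b a} (s : State r) (T : Thin s b) → Thin (advance s (blocked T)) a →
                ∀ {t} → colour s ⊢ t ⟶ b → t ≡ a
    unique-in {r} {b} {a} s T A {t} t⟶b = decidable-stable (t ≟ a) contradict
      where
      s₁ = advance s (blocked T)
      s₂ = advance s₁ (blocked A)
      z = proj₁ (thin-exists s₂)
      Z = proj₂ (thin-exists s₂)
      s₃ = advance s₂ (blocked Z)
      y = proj₁ (blocked-exists s₃)
      Y = proj₂ (blocked-exists s₃)
      a⟶b : colour s ⊢ a ⟶ b
      a⟶b = Advance.next-in s (blocked T) (blocked A)
      z∼a : z ∼ a
      z∼a = adjacent (Advance.next-in s₁ (blocked A) (blocked Z))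
      y⟶z : colour s₂ ⊢ y ⟶ z
      y⟶z = Advance.next-in s₂ (blocked Z) Y
      t~a : Twin t a
      t~a = twins T t⟶b a⟶b
      into-z : ∀ {x} → x ∼ z → x ≢ a → colour s₂ ⊢ x ⟶ z
      into-z x∼z x≢a with orient (proper s₂) x∼z
      ... | inj₁ p = p
      ... | inj₂ p = ⊥-elim (x≢a (only (blocked Z) p))
      contradict : ¬ (t ≢ a)
      contradict t≢a = no-cone s₃ (to-root Y) (sweep s₃ Shape (inj₁ refl) up)
        where
        c₃ = colour s₃
        t⟶z : colour s₂ ⊢ t ⟶ z
        t⟶z = into-z (proj₂ (t~a z) (∼-sym z∼a)) t≢a
        all-twins : ∀ {x} → x ∼ z → Twin x y
        all-twins {x} x∼z with x ≟ a
        ... | yes refl = Twin-trans (Twin-sym t~a) (twins Z t⟶z y⟶z)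
        ... | no x≢a   = twins Z (into-z x∼z x≢a) y⟶z
        Shape : V → Set
        Shape v = v ≡ z ⊎ c₃ ⊢ v ⟶ y ⊎ c₃ ⊢ v ⟶ z
        up : ∀ {u v} → c₃ ⊢ u ⟶ v → Shape v → Shape u
        up p (inj₁ refl)        = inj₂ (inj₂ p)
        up p (inj₂ (inj₁ v⟶y)) = ⊥-elim (source Y v⟶y p)
        up {u} p (inj₂ (inj₂ v⟶z))
          with orient (proper s₃) (proj₁ (all-twins (adjacent v⟶z) u) (∼-sym (adjacent p)))
        ... | inj₁ y⟶u = inj₁ (only Y y⟶u)
        ... | inj₂ u⟶y = inj₂ (inj₁ u⟶y)

    -- The chain of vertices of degree two

    record Link : Set where
      field
        {base next} : V
        state : State base
        thin  : Thin state next

    open Link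

    follow : Link → Link
    follow l = record { thin = proj₂ (thin-exists (advance (state l) (blocked (thin l)))) }

    -- The only out-neighbour is the root because `next l` is blocked; the only in-neighbour comes
    -- from `unique-in`.
    follow-neighbours : ∀ l {t} → t ∼ next l → t ≡ base l ⊎ t ≡ next (follow l)
    follow-neighbours l t∼b with orient (proper (state l)) t∼b
    ... | inj₁ t⟶b = inj₂ (unique-in (state l) (thin l) (thin (follow l)) t⟶b)
    ... | inj₂ b⟶t = inj₁ (only (blocked (thin l)) b⟶t)

    follow-in : ∀ l → colour (state l) ⊢ next (follow l) ⟶ next l
    follow-in l = Advance.next-in (state l) (blocked (thin l)) (blocked (thin (follow l)))

    follow-distinct : ∀ l → next (follow l) ≢ base l
    follow-distinct l e = sink (state l) (subst (colour (state l) ⊢_⟶ next l) e (follow-in l))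

    -- The chain seen in one fixed colouring

    -- Edges are taken in the state rooted at X 1, whose predecessor X 0 on the chain is good there.
    module Endgame (v₀ : V) (c₀ : V → Fin 3) (pr₀ : Proper G 3 c₀) where

      link : ℕ → Link
      link zero    = record { thin = proj₂ (thin-exists (root walks v₀ c₀ pr₀)) }
      link (suc k) = follow (link k)

      abstract

        X : ℕ → V
        X k = base (link k)

        s : State (X 1)
        s = state (link 1)

        neighbours : ∀ k {t} → t ∼ X (suc k) → t ≡ X k ⊎ t ≡ X (suc (suc k))
        neighbours k = follow-neighbours (link k)

        ∼-chain : ∀ k → X k ∼ X (suc k)
        ∼-chain k = ∼-sym (adjacent (to-root (blocked (thin (link k)))))

        skip : ∀ k → X (suc (suc k)) ≢ X k
        skip k = follow-distinct (link k)

        -- A blocked vertex of `s` pointed to `X 1` before the root moved there, but at that time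
        -- `X 0` was the root and hence a sink.
        X0-unblocked : ¬ Blocked s (X 0)
        X0-unblocked B = sink (state (link 0)) (Advance.next-in (state (link 0)) (blocked (thin (link 0))) B)

        e21 : colour s ⊢ X 2 ⟶ X 1
        e21 = to-root (blocked (thin (link 1)))

        e32 : colour s ⊢ X 3 ⟶ X 2
        e32 = follow-in (link 1)

        X3-source : ∀ {w} → ¬ (colour s ⊢ w ⟶ X 3)
        X3-source = source (blocked (thin (link 1))) (follow-in (link 1))

      c : V → Fin 3
      c = colour s

      infix 4 _⟶_
      _⟶_ : V → V → Set
      u ⟶ v = c ⊢ u ⟶ v

      leaves-root : ∀ {u w} → u ⟶ w → u ≢ X 1
      leaves-root {w = w} p e = sink s (subst (_⟶ w) e p)

      enters-source : ∀ {u w} → w ⟶ u → u ≢ X 3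
      enters-source {w = w} p e = X3-source (subst (w ⟶_) e p)

      loopless : ∀ {u w} → u ⟶ w → w ≢ u
      loopless {u} p e = ⟶-irrefl (subst (u ⟶_) e p)

      onward : ∀ k → X k ⟶ X (suc k) → X (suc k) ≢ X 1 → X (suc k) ⟶ X (suc (suc k))
      onward k p ≢root with out s ≢root
      ... | w , q with neighbours k (∼-sym (adjacent q))
      ...   | inj₁ e = ⊥-elim (⟶-asym p (subst (X (suc k) ⟶_) e q))
      ...   | inj₂ e = subst (X (suc k) ⟶_) e q

      predecessor : ∀ k {u} → X (suc k) ⟶ X (suc (suc k)) → u ⟶ X (suc k) → u ≡ X k
      predecessor k p q with neighbours k (adjacent q)
      ... | inj₁ e = e
      ... | inj₂ e = ⊥-elim (⟶-asym p (subst (_⟶ X (suc k)) e q))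

      into-X2 : ∀ {u} → u ⟶ X 2 → u ≡ X 3
      into-X2 q with neighbours 1 (adjacent q)
      ... | inj₁ e = ⊥-elim (leaves-root q e)
      ... | inj₂ e = e

      e34 : X 3 ⟶ X 4
      e34 with orient (proper s) (∼-chain 3)
      ... | inj₁ p = p
      ... | inj₂ p = ⊥-elim (X3-source p)

      e45 : X 4 ⟶ X 5
      e45 = onward 3 e34 λ e → no-shortcut e32 e21 (subst (X 3 ⟶_) e e34)

      before-X1 : ∀ {u} → u ⟶ X 1 → u ≢ X 2 → u ≡ X 0
      before-X1 p u≢ with neighbours 0 (adjacent p)
      ... | inj₁ e = e
      ... | inj₂ e = ⊥-elim (u≢ e)

      -- If the chain closed here, `X 4` would be `X 0`, and the graph would consist of the
      -- bipartite cycle through `X 1` to `X 4`.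
      not-4-cycle : X 5 ≢ X 1
      not-4-cycle 5≡1 = no-cone s e21 (sweep s Shape (inj₁ refl) up)
        where
        Shape : V → Set
        Shape v = v ≡ X 1 ⊎ v ⟶ X 2 ⊎ v ⟶ X 1
        4≡0 : X 4 ≡ X 0
        4≡0 = before-X1 (subst (X 4 ⟶_) 5≡1 e45) (skip 2)
        up : ∀ {x y} → x ⟶ y → Shape y → Shape x
        up {x} p (inj₁ e) = inj₂ (inj₂ (subst (x ⟶_) e p))
        up {x} p (inj₂ (inj₁ q)) = ⊥-elim (X3-source (subst (x ⟶_) (into-X2 q) p))
        up {x} {y} p (inj₂ (inj₂ q)) with y ≟ X 2
        ... | yes e  = inj₂ (inj₁ (subst (x ⟶_) e p))
        ... | no y≢2 = inj₂ (inj₁ (subst (_⟶ X 2) (≡-sym x≡3) e32))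
          where
          x≡3 : x ≡ X 3
          x≡3 = predecessor 3 e45 (subst (x ⟶_) (trans (before-X1 q y≢2) (≡-sym 4≡0)) p)

      e56 : X 5 ⟶ X 6
      e56 = onward 4 e45 not-4-cycle

      -- Relative to `X 3`, the colours of `X 3` to `X 8` are 0, 1, 2, 0, 1, 2, and the root has 2.
      -- Colours alone thus show that `X 6` and `X 7` are not the root, and `X 8` is the first
      -- vertex left undecided.
      root-level : c (X 1) ≡ rot (rot (c (X 3)))
      root-level = trans (successor e21) (cong rot (successor e32))

      X6-level : c (X 6) ≡ c (X 3)
      X6-level = trans (successor e56) (trans (cong rot (successor e45))
        (trans (cong (λ k → rot (rot k)) (successor e34)) (rot³ (c (X 3)))))

      e67 : X 6 ⟶ X 7
      e67 = onward 5 e56 λ e →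
        rot²≢ (c (X 3)) (trans (≡-sym X6-level) (trans (cong c e) root-level))

      e78 : X 7 ⟶ X 8
      e78 = onward 6 e67 λ e →
        rot≢ (rot (c (X 3))) (trans (trans (cong rot (≡-sym X6-level)) (≡-sym (successor e67)))
                                (trans (cong c e) root-level))

      7≢4 : X 7 ≢ X 4
      7≢4 e = enters-source e56 (predecessor 3 e45 (subst (X 6 ⟶_) e e67))

      7≢2 : X 7 ≢ X 2
      7≢2 e = enters-source e56 (into-X2 (subst (X 6 ⟶_) e e67))

      5≢2 : X 5 ≢ X 2
      5≢2 e = loopless e34 (into-X2 (subst (X 4 ⟶_) e e45))

      -- The chain closes to a seven-cycle

      module Seven (8≡1 : X 8 ≡ X 1) where

        -- The numbering starts at `X 1` because `neighbours` says nothing about `X 0`.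
        f : Fin 7 → V
        f i = X (suc (toℕ i))

        prev7 : Fin 7 → Fin 7
        prev7 zero    = fromℕ 6
        prev7 (suc i) = inject₁ i

        next7-prev7 : ∀ i → next7 (prev7 i) ≡ i
        next7-prev7 zero = refl
        next7-prev7 (suc zero) = refl
        next7-prev7 (suc (suc zero)) = refl
        next7-prev7 (suc (suc (suc zero))) = refl
        next7-prev7 (suc (suc (suc (suc zero)))) = refl
        next7-prev7 (suc (suc (suc (suc (suc zero))))) = refl
        next7-prev7 (suc (suc (suc (suc (suc (suc zero)))))) = refl

        f-next : ∀ i → f (next7 i) ≡ X (suc (suc (toℕ i)))
        f-next zero = refl
        f-next (suc zero) = refl
        f-next (suc (suc zero)) = refl
        f-next (suc (suc (suc zero))) = refl
        f-next (suc (suc (suc (suc zero)))) = refl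
        f-next (suc (suc (suc (suc (suc zero))))) = refl
        f-next (suc (suc (suc (suc (suc (suc zero)))))) = ≡-sym 8≡1

        f-prev : ∀ i → f (prev7 i) ≡ X (toℕ i)
        -- `X 7` points to the root and is not `X 2`, so it is the other neighbour `X 0`.
        f-prev zero    = before-X1 (subst (X 7 ⟶_) 8≡1 e78) 7≢2
        f-prev (suc i) = cong (λ k → X (suc k)) (toℕ-inject₁ i)

        f-neighbours : ∀ i {y} → y ∼ f i → y ≡ f (prev7 i) ⊎ y ≡ f (next7 i)
        f-neighbours i y∼ with neighbours (toℕ i) y∼
        ... | inj₁ e = inj₁ (trans e (≡-sym (f-prev i)))
        ... | inj₂ e = inj₂ (trans e (≡-sym (f-next i)))

        f-adjacent : ∀ i → f i ∼ f (next7 i)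
        f-adjacent i = subst (f i ∼_) (≡-sym (f-next i)) (∼-chain (suc (toℕ i)))

        cover : ∀ v → ∃ λ i → f i ≡ v
        cover = connected-closed walks (λ v → ∃ λ i → f i ≡ v) (λ v → any? λ i → f i ≟ v)
                  (zero , refl) closed
          where
          closed : ∀ {x y} → (∃ λ i → f i ≡ x) → x ∼ y → ∃ λ i → f i ≡ y
          closed (i , refl) x∼y with f-neighbours i (∼-sym x∼y)
          ... | inj₁ e = prev7 i , ≡-sym e
          ... | inj₂ e = next7 i , ≡-sym e

        -- The sink `X 1` differs from every vertex with an out-neighbour, and the source `X 3` from
        -- every vertex with an in-neighbour. The remaining pairs are separated by `loopless`, by
        -- `skip`, or by their unique in-neighbours.
        f-distinct : ∀ i j → i < j → f j ≢ f i
        f-distinct _ zero ()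
        f-distinct zero (suc zero) _ = leaves-root e21
        f-distinct zero (suc (suc zero)) _ = leaves-root e32
        f-distinct zero (suc (suc (suc zero))) _ = leaves-root e45
        f-distinct zero (suc (suc (suc (suc zero)))) _ = leaves-root e56
        f-distinct zero (suc (suc (suc (suc (suc zero))))) _ = leaves-root e67
        f-distinct zero (suc (suc (suc (suc (suc (suc zero)))))) _ = leaves-root e78
        f-distinct (suc _) (suc zero) (s≤s ())
        f-distinct (suc zero) (suc (suc zero)) _ = λ e → loopless e32 (≡-sym e)
        f-distinct (suc zero) (suc (suc (suc zero))) _ = skip 2
        f-distinct (suc zero) (suc (suc (suc (suc zero)))) _ = 5≢2
        f-distinct (suc zero) (suc (suc (suc (suc (suc zero))))) _ = λ e →
          enters-source e45 (into-X2 (subst (X 5 ⟶_) e e56))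
        f-distinct (suc zero) (suc (suc (suc (suc (suc (suc zero)))))) _ = 7≢2
        f-distinct (suc (suc _)) (suc (suc zero)) (s≤s (s≤s ()))
        f-distinct (suc (suc zero)) (suc (suc (suc zero))) _ = enters-source e34
        f-distinct (suc (suc zero)) (suc (suc (suc (suc zero)))) _ = enters-source e45
        f-distinct (suc (suc zero)) (suc (suc (suc (suc (suc zero))))) _ = enters-source e56
        f-distinct (suc (suc zero)) (suc (suc (suc (suc (suc (suc zero)))))) _ = enters-source e67
        f-distinct (suc (suc (suc _))) (suc (suc (suc zero))) (s≤s (s≤s (s≤s ())))
        f-distinct (suc (suc (suc zero))) (suc (suc (suc (suc zero)))) _ = loopless e45
        f-distinct (suc (suc (suc zero))) (suc (suc (suc (suc (suc zero))))) _ = skip 4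
        f-distinct (suc (suc (suc zero))) (suc (suc (suc (suc (suc (suc zero)))))) _ = 7≢4
        f-distinct (suc (suc (suc (suc _)))) (suc (suc (suc (suc zero)))) (s≤s (s≤s (s≤s (s≤s ()))))
        f-distinct (suc (suc (suc (suc zero)))) (suc (suc (suc (suc (suc zero))))) _ = loopless e56
        f-distinct (suc (suc (suc (suc zero)))) (suc (suc (suc (suc (suc (suc zero)))))) _ = skip 5
        f-distinct (suc (suc (suc (suc (suc _))))) (suc (suc (suc (suc (suc zero)))))
          (s≤s (s≤s (s≤s (s≤s (s≤s ())))))
        f-distinct (suc (suc (suc (suc (suc zero))))) (suc (suc (suc (suc (suc (suc zero)))))) _ = loopless e67
        f-distinct (suc (suc (suc (suc (suc (suc _)))))) (suc (suc (suc (suc (suc (suc zero))))))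
          (s≤s (s≤s (s≤s (s≤s (s≤s (s≤s ()))))))

        f-injective : ∀ {i j} → f i ≡ f j → i ≡ j
        f-injective {i} {j} e with <-cmp i j
        ... | tri< lt _ _ = ⊥-elim (f-distinct i j lt (≡-sym e))
        ... | tri≈ _ i≡j _ = i≡j
        ... | tri> _ _ gt = ⊥-elim (f-distinct j i gt e)

        iso : IsoC7 G
        iso = mk↔ₛ′ to f (λ i → f-injective (proj₂ (cover (f i)))) (λ v → proj₂ (cover v))
            , λ u v → fwd u v , bwd u v
          where
          to : V → Fin 7
          to v = proj₁ (cover v)
          fwd : ∀ u v → u ∼ v → C7Adj (to u) (to v)
          fwd u v u∼v with f-neighbours (to u)
            (∼-sym (subst (_∼ f (to v)) (≡-sym (proj₂ (cover u))) (subst (u ∼_) (≡-sym (proj₂ (cover v))) u∼v)))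
          ... | inj₁ e = inj₂ (trans (≡-sym (next7-prev7 (to u))) (cong next7 (≡-sym (f-injective e))))
          ... | inj₂ e = inj₁ (f-injective e)
          bwd : ∀ u v → C7Adj (to u) (to v) → u ∼ v
          bwd u v adj7 = subst (_∼ v) (proj₂ (cover u)) (subst (f (to u) ∼_) (proj₂ (cover v)) (on-f adj7))
            where
            on-f : C7Adj (to u) (to v) → f (to u) ∼ f (to v)
            on-f (inj₁ e) = subst (λ j → f (to u) ∼ f j) (≡-sym e) (f-adjacent (to u))
            on-f (inj₂ e) = ∼-sym (subst (λ j → f (to v) ∼ f j) (≡-sym e) (f-adjacent (to v)))

      -- Exchanging two colours on a longer chain

      -- Exchanging the colours of X 4 and X 5 reverses X 3 → X 4 → X 5 → X 6, leaving the two
      -- long directed paths X 6 → … → X 1 and X 6 → X 7 → X 8 → ….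
      module Swap (8≢1 : X 8 ≢ X 1) where

        swap : V → Fin 3
        swap v with v ≟ X 4 | v ≟ X 5
        ... | yes _ | _     = c (X 5)
        ... | no _  | yes _ = c (X 4)
        ... | no _  | no _  = c v

        4≢5 : X 4 ≢ X 5
        4≢5 e = loopless e45 (≡-sym e)

        swap-4 : swap (X 4) ≡ c (X 5)
        swap-4 with X 4 ≟ X 4 | X 4 ≟ X 5
        ... | yes _ | _ = refl
        ... | no ≢  | _ = ⊥-elim (≢ refl)

        swap-5 : swap (X 5) ≡ c (X 4)
        swap-5 with X 5 ≟ X 4 | X 5 ≟ X 5
        ... | yes e | _     = ⊥-elim (4≢5 (≡-sym e))
        ... | no _  | yes _ = refl
        ... | no _  | no ≢  = ⊥-elim (≢ refl)

        Apart : V → Set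
        Apart v = v ≢ X 4 × v ≢ X 5

        swap-apart : ∀ {v} → Apart v → swap v ≡ c v
        swap-apart {v} (≢4 , ≢5) with v ≟ X 4 | v ≟ X 5
        ... | yes e | _     = ⊥-elim (≢4 e)
        ... | no _  | yes e = ⊥-elim (≢5 e)
        ... | no _  | no _  = refl

        keep : ∀ {u v} → Apart u → Apart v → u ⟶ v → swap ⊢ u ⟶ v
        keep u v (edge a e) = edge a (trans (swap-apart v) (trans e (cong rot (≡-sym (swap-apart u)))))

        apart-1 : Apart (X 1)
        apart-1 = (λ e → leaves-root e45 (≡-sym e)) , (λ e → leaves-root e56 (≡-sym e))

        apart-2 : Apart (X 2)
        apart-2 = (λ e → skip 2 (≡-sym e)) , (λ e → 5≢2 (≡-sym e))

        apart-3 : Apart (X 3)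
        apart-3 = (λ e → enters-source e34 (≡-sym e)) , (λ e → enters-source e45 (≡-sym e))

        apart-6 : Apart (X 6)
        apart-6 = skip 4 , loopless e56

        apart-7 : Apart (X 7)
        apart-7 = 7≢4 , skip 5

        apart-8 : Apart (X 8)
        apart-8 =
          (λ e → enters-source e67 (predecessor 3 e45 (subst (X 7 ⟶_) e e78))) ,
          (λ e → 7≢4 (predecessor 4 e56 (subst (X 7 ⟶_) e e78)))

        f21 : swap ⊢ X 2 ⟶ X 1
        f21 = keep apart-2 apart-1 e21

        f32 : swap ⊢ X 3 ⟶ X 2
        f32 = keep apart-3 apart-2 e32

        f43 : swap ⊢ X 4 ⟶ X 3
        f43 = edge (∼-sym (∼-chain 3)) (begin
          swap (X 3)                  ≡⟨ swap-apart apart-3 ⟩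
          c (X 3)                     ≡⟨ ≡-sym (rot³ (c (X 3))) ⟩
          rot (rot (rot (c (X 3))))   ≡⟨ cong (λ k → rot (rot k)) (≡-sym (successor e34)) ⟩
          rot (rot (c (X 4)))         ≡⟨ cong rot (≡-sym (successor e45)) ⟩
          rot (c (X 5))               ≡⟨ cong rot (≡-sym swap-4) ⟩
          rot (swap (X 4))            ∎)
          where open ≡-Reasoning

        f54 : swap ⊢ X 5 ⟶ X 4
        f54 = edge (∼-sym (∼-chain 4)) (trans swap-4 (trans (successor e45) (cong rot (≡-sym swap-5))))

        f65 : swap ⊢ X 6 ⟶ X 5
        f65 = edge (∼-sym (∼-chain 5)) (begin
          swap (X 5)                  ≡⟨ swap-5 ⟩
          c (X 4)                     ≡⟨ ≡-sym (rot³ (c (X 4))) ⟩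
          rot (rot (rot (c (X 4))))   ≡⟨ cong (λ k → rot (rot k)) (≡-sym (successor e45)) ⟩
          rot (rot (c (X 5)))         ≡⟨ cong rot (≡-sym (successor e56)) ⟩
          rot (c (X 6))               ≡⟨ cong rot (≡-sym (swap-apart apart-6)) ⟩
          rot (swap (X 6))            ∎)
          where open ≡-Reasoning

        f67 : swap ⊢ X 6 ⟶ X 7
        f67 = keep apart-6 apart-7 e67

        f78 : swap ⊢ X 7 ⟶ X 8
        f78 = keep apart-7 apart-8 e78

        tail≢head : ∀ {u v} → swap ⊢ u ⟶ v → swap u ≢ swap v
        tail≢head {u} p e = rot≢ (swap u) (trans e (successor p))

        head≢tail : ∀ {u v} → swap ⊢ u ⟶ v → swap v ≢ swap u
        head≢tail p e = tail≢head p (≡-sym e)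

        proper-4 : ∀ {v} → v ∼ X 4 → swap (X 4) ≢ swap v
        proper-4 v∼4 with neighbours 3 v∼4
        ... | inj₁ refl = tail≢head f43
        ... | inj₂ refl = head≢tail f54

        proper-5 : ∀ {v} → v ∼ X 5 → swap (X 5) ≢ swap v
        proper-5 v∼5 with neighbours 4 v∼5
        ... | inj₁ refl = tail≢head f54
        ... | inj₂ refl = head≢tail f65

        swap-proper : Proper G 3 swap
        swap-proper u v u∼v = go (u ≟ X 4) (u ≟ X 5) (v ≟ X 4) (v ≟ X 5)
          where
          go : Dec (u ≡ X 4) → Dec (u ≡ X 5) → Dec (v ≡ X 4) → Dec (v ≡ X 5) → swap u ≢ swap v
          go (yes refl) _ _ _ = proper-4 (∼-sym u∼v)
          go _ (yes refl) _ _ = proper-5 (∼-sym u∼v)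
          go _ _ (yes refl) _ = λ e → proper-4 u∼v (≡-sym e)
          go _ _ _ (yes refl) = λ e → proper-5 u∼v (≡-sym e)
          go (no u≢4) (no u≢5) (no v≢4) (no v≢5) e =
            proper s u v u∼v (trans (≡-sym (swap-apart (u≢4 , u≢5))) (trans e (swap-apart (v≢4 , v≢5))))

        record Far (v : V) : Set where
          field
            ≢2 : v ≢ X 2
            ≢3 : v ≢ X 3
            ≢4 : v ≢ X 4
            ≢5 : v ≢ X 5
            ≢6 : v ≢ X 6

        open Far

        apart : ∀ {v} → Far v → Apart v
        apart F = ≢4 F , ≢5 F

        -- `X 3` is a source, and each of `X 2`, `X 4`, `X 5`, `X 6` has its only in-neighbour in
        -- this stretch, so no edge enters it from outside.
        far-out : ∀ {v w} → Far v → v ⟶ w → Far w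
        far-out {v} {w} F p = record
          { ≢2 = λ e → ≢3 F (into-X2 (subst (v ⟶_) e p))
          ; ≢3 = enters-source p
          ; ≢4 = λ e → ≢3 F (predecessor 3 e45 (subst (v ⟶_) e p))
          ; ≢5 = λ e → ≢4 F (predecessor 4 e56 (subst (v ⟶_) e p))
          ; ≢6 = λ e → ≢5 F (predecessor 5 e67 (subst (v ⟶_) e p))
          }

        -- A path of length two out of `v` stays far and survives. If the chosen out-neighbour of
        -- `v` is the root, then `v` is `X 0`, which is good for `c`, and its path avoids the two
        -- recoloured vertices.
        good-far : ∀ {v} → Far v → v ≢ X 1 → Good swap v
        good-far {v} F v≢1 with out s v≢1
        ... | w , v⟶w with exit-or-root s w
        ...   | inj₂ (x , w⟶x) = inj₁ (w , x , keep (apart F) (apart Fw) v⟶w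
                                              , keep (apart Fw) (apart (far-out Fw w⟶x)) w⟶x)
          where
          Fw : Far w
          Fw = far-out F v⟶w
        ...   | inj₁ w≡1 = from-good (decidable-stable (Good? c v) unblocked)
          where
          v⟶1 : v ⟶ X 1
          v⟶1 = subst (v ⟶_) w≡1 v⟶w
          unblocked : ¬ ¬ Good c v
          unblocked bad = X0-unblocked (subst (Blocked s) (before-X1 v⟶1 (≢2 F)) (¬Good⇒Blocked s bad))
          from-good : Good c v → Good swap v
          from-good (inj₁ (y , z , p , q)) = inj₁ (y , z , keep (apart F) (apart Fy) p
                                                       , keep (apart Fy) (apart (far-out Fy q)) q)
            where
            Fy : Far y
            Fy = far-out F p
          from-good (inj₂ (u , t , p , q)) = inj₂ (u , t , keep apart-u (apart F) p , keep apart-t apart-u q)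
            where
            successor-on-chain : ∀ k {x y} → X k ⟶ X (suc k) → x ≡ X (suc k) → x ⟶ y → y ≡ X (suc (suc k))
            successor-on-chain k {x} {y} k⟶ refl x⟶y with neighbours k (∼-sym (adjacent x⟶y))
            ... | inj₁ e = ⊥-elim (⟶-asym k⟶ (subst (x ⟶_) e x⟶y))
            ... | inj₂ e = e
            apart-u : Apart u
            apart-u = (λ e → ≢5 F (successor-on-chain 3 e34 e p)) , (λ e → ≢6 F (successor-on-chain 4 e45 e p))
            apart-t : Apart t
            apart-t =
              (λ e → proj₂ apart-u (successor-on-chain 3 e34 e q)) ,
              -- If `t` were `X 5`, then `v` would be `X 7`, and the root, an out-neighbour of `v`,
              -- would be `X 8`.
              (λ e → 8≢1 (≡-sym (successor-on-chain 6 e67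
                 (successor-on-chain 5 e56 (successor-on-chain 4 e45 e q) p) v⟶1)))

        all-good : ∀ v → Good swap v
        all-good v = go (v ≟ X 1) (v ≟ X 2) (v ≟ X 3) (v ≟ X 4) (v ≟ X 5) (v ≟ X 6)
          where
          go : Dec (v ≡ X 1) → Dec (v ≡ X 2) → Dec (v ≡ X 3) → Dec (v ≡ X 4) → Dec (v ≡ X 5) → Dec (v ≡ X 6) →
               Good swap v
          go (yes refl) _ _ _ _ _ = inj₂ (_ , _ , f21 , f32)
          go _ (yes refl) _ _ _ _ = inj₂ (_ , _ , f32 , f43)
          go _ _ (yes refl) _ _ _ = inj₁ (_ , _ , f32 , f21)
          go _ _ _ (yes refl) _ _ = inj₁ (_ , _ , f43 , f32)
          go _ _ _ _ (yes refl) _ = inj₁ (_ , _ , f54 , f43)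
          go _ _ _ _ _ (yes refl) = inj₁ (_ , _ , f67 , f78)
          go (no 1≢) (no 2≢) (no 3≢) (no 4≢) (no 5≢) (no 6≢) =
            good-far (record { ≢2 = 2≢ ; ≢3 = 3≢ ; ≢4 = 4≢ ; ≢5 = 5≢ ; ≢6 = 6≢ }) 1≢

      conclusion : ¬ ¬ IsoC7 G
      conclusion not-7 with X 8 ≟ X 1
      ... | yes 8≡1 = not-7 (Seven.iso 8≡1)
      ... | no 8≢1  = no-good swap swap-proper all-good
        where open Swap 8≢1

-- Finite search over colourings

any-vector? : ∀ {k m} {P : Vec (Fin k) m → Set} → (∀ v → Dec (P v)) → Dec (∃ P)
any-vector? {m = zero}  P? = map′ (λ p → [] , p) (λ { ([] , p) → p }) (P? [])
any-vector? {m = suc m} P? = map′ (λ (i , v , p) → i ∷ v , p) (λ { (i ∷ v , p) → i , v , p })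
  (any? λ i → any-vector? λ v → P? (i ∷ v))

theorem1 : (G : Graph) → Connected G → ChromaticNumber G 3 → ¬ IsoC7 G →
    Σ (Fin (n G) → Fin 3) λ c → Proper G 3 c × (∀ x → ColorfulPathFrom G c x)
theorem1 G (v , walks) ((c , pr) , not-2) not-7
  -- Deciding whether a good colouring exists makes the argument by contradiction constructive.
  -- Colourings are enumerated as vectors, and an arbitrary one is compared with its table
  -- pointwise.
  with any-vector? (λ w → Orientation.Proper? G (lookup w) ×-dec all? (Orientation.Good? G (lookup w)))
... | yes (w , pr′ , good) = lookup w , pr′ , λ x → Orientation.Good⇒Colorful G pr′ (good x)
... | no none = ⊥-elim (Counterexample.Endgame.conclusion walks not-2 no-good v c pr not-7)
  where
  open Orientation G
  no-good : ∀ c → Proper G 3 c → ¬ (∀ x → Good c x)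
  no-good c pr good = none
    ( tabulate c
    , (λ u v u∼v e → pr u v u∼v (trans (≡-sym (lookup∘tabulate c u)) (trans e (lookup∘tabulate c v))))
    , λ x → Good-resp (λ y → ≡-sym (lookup∘tabulate c y)) (good x))
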